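{- Let $W$ be the Weyl group of a finite crystallographic root system, $w\in W$, and $I\subseteq J(w)$. If $w$ is $I$-spherical (i.e. has an $I$-witness), then there exists an $I$-witness $R$ of $w$ of the form $R=R'R''$ (concatenation) where $R'$ is a reduced expression of $w_0(I)$ and $R''$ is a reduced expression of $w_0(I)w$.
   Context: $W$ has simple generators $s_1,\dots,s_r$ indexed by the nodes $[r]=\{1,\dots,r\}$ of the Dynkin diagram $\mathcal G$; $\ell$ is Coxeter length, and $J(w)=\{j\in[r]:\ell(s_jw)<\ell(w)\}$ is the set of left descents. For $I\subseteq[r]$, $w_0(I)$ is the longest element of the parabolic subgroup generated by $\{s_i:i\in I\}$; the induced subdiagram $\mathcal G_I$ decomposes into connected components $\mathcal C^{(1)},\dots,\mathcal C^{(m)}$, and $w_0^{(z)}$ is the longest element of the parabolic subgroup generated by $\{s_j: j\in\mathcal C^{(z)}\}$. An $I$-witness of $w$ is a reduced expression $R=s_{i_1}\cdots s_{i_{\ell(w)}}$ of $w$ such that $\#\{t: i_t=j\}\le 1$ for all $j\in[r]\setminus I$, and $\#\{t: i_t\in\mathcal C^{(z)}\}\le \ell(w_0^{(z)})+\#\mathrm{vertices}(\mathcal C^{(z)})$ for $1\le z\le m$. $w$ is $I$-spherical if it has an $I$-witness. -}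

module Defs where

open import Algebra.Bundles using (CommutativeRing)
open import Algebra.Core using (Op₁; Op₂)
import Algebra.Definitions.RawMonoid as RawMonoidDefs
open import Algebra.Module.Bundles using (LeftModule)
open import Algebra.Structures using (IsCommutativeRing)
open import Data.Fin.Base using (Fin)
open import Data.Fin.Properties using (_≟_)
open import Data.Fin.Subset using (Subset; _∈_; _∉_; ∣_∣)
open import Data.Fin.Subset.Properties using (_∈?_)
open import Data.Integer.Base using (ℤ; +_; -[1+_])
open import Data.List.Base using (List; []; _∷_; _++_; foldr; length; filter)
open import Data.List.Relation.Unary.All using (All)
open import Data.Nat.Base as ℕ using (ℕ)
open import Data.Product.Base using (∃; ∃₂; _×_; _,_; proj₁; proj₂)
open import Data.Sum.Base using (_⊎_)
open import Function.Bundles using (_⇔_)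
open import Level using (Level; _⊔_; suc)
open import Relation.Binary.Construct.Closure.ReflexiveTransitive using (Star)
open import Relation.Binary.Core using (Rel)
open import Relation.Binary.PropositionalEquality.Core using (_≡_; _≢_)
open import Relation.Binary.Structures using (IsStrictTotalOrder)
open import Relation.Nullary.Negation.Core using (¬_)

-- The base field.  It is not fixed: ℚ is an instance, and so is ℝ in a
-- classical metatheory.  The inverse is total; its value at 0# is junk.

record OrderedField (c ℓ₁ ℓ₂ : Level) : Set (suc (c ⊔ ℓ₁ ⊔ ℓ₂)) where
  infix  8 -_
  infix  9 _⁻¹
  infixl 7 _*_
  infixl 6 _+_
  infix  4 _≈_ _<_
  field
    Carrier            : Set c
    _≈_                : Rel Carrier ℓ₁
    _<_                : Rel Carrier ℓ₂
    _+_ _*_            : Op₂ Carrier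
    -_ _⁻¹             : Op₁ Carrier
    0# 1#              : Carrier
    isCommutativeRing  : IsCommutativeRing _≈_ _+_ _*_ -_ 0# 1#
    isStrictTotalOrder : IsStrictTotalOrder _≈_ _<_
    ⁻¹-cong            : ∀ {x y} → x ≈ y → x ⁻¹ ≈ y ⁻¹
    *-inverseʳ         : ∀ x → ¬ (x ≈ 0#) → x * x ⁻¹ ≈ 1#
    0<1                : 0# < 1#
    +-monoˡ-<          : ∀ z {x y} → x < y → x + z < y + z
    *-pos              : ∀ {x y} → 0# < x → 0# < y → 0# < x * y

  commutativeRing : CommutativeRing c ℓ₁
  commutativeRing = record { isCommutativeRing = isCommutativeRing }

  open CommutativeRing commutativeRing public using (ring; +-rawMonoid)
  open RawMonoidDefs +-rawMonoid using () renaming (_×_ to _×#_)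

  fromℤ : ℤ → Carrier
  fromℤ (+ n)    = n ×# 1#
  fromℤ -[1+ n ] = - (ℕ.suc n ×# 1#)

-- Finite dimensionality is not a field: it follows once a root system spans.

record EuclideanSpace {c ℓ₁ ℓ₂ : Level} (K : OrderedField c ℓ₁ ℓ₂) (m ℓm : Level)
       : Set (c ⊔ ℓ₁ ⊔ ℓ₂ ⊔ suc (m ⊔ ℓm)) where
  open OrderedField K
  field
    leftModule : LeftModule ring m ℓm
  open LeftModule leftModule public
    using (Carrierᴹ; _≈ᴹ_; _+ᴹ_; _*ₗ_; 0ᴹ; -ᴹ_; +ᴹ-rawMonoid)
  field
    ⟨_,_⟩            : Carrierᴹ → Carrierᴹ → Carrier
    ⟨,⟩-cong         : ∀ {u u′ v v′} → u ≈ᴹ u′ → v ≈ᴹ v′ → ⟨ u , v ⟩ ≈ ⟨ u′ , v′ ⟩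
    ⟨,⟩-sym          : ∀ u v → ⟨ u , v ⟩ ≈ ⟨ v , u ⟩
    ⟨,⟩-+ˡ           : ∀ u u′ v → ⟨ u +ᴹ u′ , v ⟩ ≈ ⟨ u , v ⟩ + ⟨ u′ , v ⟩
    ⟨,⟩-*ˡ           : ∀ x u v → ⟨ x *ₗ u , v ⟩ ≈ x * ⟨ u , v ⟩
    positiveDefinite : ∀ v → ¬ (v ≈ᴹ 0ᴹ) → 0# < ⟨ v , v ⟩

  open RawMonoidDefs +ᴹ-rawMonoid public
    using () renaming (sum to sumᴹ; _×_ to _×ᴹ_)

  -- 2⟨v,α⟩/⟨α,α⟩
  cartan : Carrierᴹ → Carrierᴹ → Carrier
  cartan v α = (1# + 1#) * ⟨ v , α ⟩ * ⟨ α , α ⟩ ⁻¹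

  reflect : Carrierᴹ → Carrierᴹ → Carrierᴹ
  reflect α v = v +ᴹ -ᴹ (cartan v α *ₗ α)

-- A (reduced) finite crystallographic root system.  The finite set of roots is
-- given by an enumeration, in which repetitions are allowed.

record RootSystem {c ℓ₁ ℓ₂ m ℓm : Level} {K : OrderedField c ℓ₁ ℓ₂}
                  (E : EuclideanSpace K m ℓm) : Set (c ⊔ ℓ₁ ⊔ m ⊔ ℓm) where
  open OrderedField K
  open EuclideanSpace E
  field
    size             : ℕ
    root             : Fin size → Carrierᴹ
    nonzero          : ∀ a → ¬ (root a ≈ᴹ 0ᴹ)
    spanning         : ∀ v → ∃ λ (x : Fin size → Carrier) →
                       v ≈ᴹ sumᴹ (λ a → x a *ₗ root a)
    reduced          : ∀ a b x → root b ≈ᴹ x *ₗ root a →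
                       root b ≈ᴹ root a ⊎ root b ≈ᴹ -ᴹ root a
    reflectionClosed : ∀ a b → ∃ λ d → reflect (root a) (root b) ≈ᴹ root d
    crystallographic : ∀ a b → ∃ λ z → cartan (root b) (root a) ≈ fromℤ z

record SimpleSystem {c ℓ₁ ℓ₂ m ℓm : Level} {K : OrderedField c ℓ₁ ℓ₂}
                    {E : EuclideanSpace K m ℓm} (Φ : RootSystem E) (r : ℕ)
                    : Set (c ⊔ ℓ₁ ⊔ m ⊔ ℓm) where
  open OrderedField K
  open EuclideanSpace E
  open RootSystem Φ
  field
    simple : Fin r → Fin size

  simpleRoot : Fin r → Carrierᴹ
  simpleRoot i = root (simple i)

  field
    independent : ∀ (x : Fin r → Carrier) →
                  sumᴹ (λ i → x i *ₗ simpleRoot i) ≈ᴹ 0ᴹ → ∀ i → x i ≈ 0#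
    signed      : ∀ a → ∃ λ (n : Fin r → ℕ) →
                  root a ≈ᴹ sumᴹ (λ i → n i ×ᴹ simpleRoot i) ⊎
                  root a ≈ᴹ -ᴹ sumᴹ (λ i → n i ×ᴹ simpleRoot i)

module WeylGroup {c ℓ₁ ℓ₂ m ℓm : Level} {K : OrderedField c ℓ₁ ℓ₂}
                 {E : EuclideanSpace K m ℓm} {Φ : RootSystem E} {r : ℕ}
                 (Δ : SimpleSystem Φ r) where
  open OrderedField K
  open EuclideanSpace E
  open LeftModule leftModule using (≈ᴹ-refl; ≈ᴹ-trans; +ᴹ-cong; -ᴹ‿cong; *ₗ-cong)
  open CommutativeRing commutativeRing using (*-cong) renaming (refl to ≈-refl)
  open RootSystem Φ
  open SimpleSystem Δ

  reflections : List (Fin size) → Carrierᴹ → Carrierᴹ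
  reflections as v = foldr (λ a → reflect (root a)) v as

  -- The group generated by the reflections in all roots.  As reflections are
  -- involutions, its elements are exactly the finite products of reflections.

  record W : Set (m ⊔ ℓm) where
    field
      act       : Carrierᴹ → Carrierᴹ
      generated : ∃ λ (as : List (Fin size)) → ∀ v → act v ≈ᴹ reflections as v
  open W public

  infix  4 _≈ʷ_ _<ℓ_ _≤ℓ_
  infixr 7 _·_

  _≈ʷ_ : Rel W (m ⊔ ℓm)
  x ≈ʷ y = ∀ v → act x v ≈ᴹ act y v

  reflect-cong : ∀ α {u v} → u ≈ᴹ v → reflect α u ≈ᴹ reflect α v
  reflect-cong α u≈v =
    +ᴹ-cong u≈v (-ᴹ‿cong (*ₗ-cong
      (*-cong (*-cong ≈-refl (⟨,⟩-cong u≈v ≈ᴹ-refl)) ≈-refl) ≈ᴹ-refl))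

  reflections-++ : ∀ as {bs u v} → u ≈ᴹ reflections bs v →
                   reflections as u ≈ᴹ reflections (as ++ bs) v
  reflections-++ []       u≈ = u≈
  reflections-++ (a ∷ as) u≈ = reflect-cong (root a) (reflections-++ as u≈)

  ε : W
  ε = record { act = λ v → v ; generated = [] , λ _ → ≈ᴹ-refl }

  _·_ : W → W → W
  x · y = record
    { act       = λ v → act x (act y v)
    ; generated = proj₁ (generated x) ++ proj₁ (generated y)
                , λ v → ≈ᴹ-trans (proj₂ (generated x) (act y v))
                                 (reflections-++ (proj₁ (generated x))
                                                 (proj₂ (generated y) v))
    }

  s : Fin r → W
  s j = record
    { act       = reflect (simpleRoot j)
    ; generated = simple j ∷ [] , λ _ → ≈ᴹ-refl
    }

  Word : Set
  Word = List (Fin r)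

  eval : Word → W
  eval = foldr (λ j x → s j · x) ε

  -- ℓ(w) = k
  HasLength : W → ℕ → Set (m ⊔ ℓm)
  HasLength w k = (∃ λ R → eval R ≈ʷ w × length R ≡ k)
                × (∀ R → eval R ≈ʷ w → k ℕ.≤ length R)

  _<ℓ_ _≤ℓ_ : Rel W (m ⊔ ℓm)
  x <ℓ y = ∃₂ λ k l → HasLength x k × HasLength y l × k ℕ.< l
  x ≤ℓ y = ∃₂ λ k l → HasLength x k × HasLength y l × k ℕ.≤ l

  -- j ∈ J(w), written J w j.
  J : W → Fin r → Set (m ⊔ ℓm)
  J w j = s j · w <ℓ w

  IsReducedExpression : Word → W → Set (m ⊔ ℓm)
  IsReducedExpression R w = eval R ≈ʷ w × HasLength w (length R)

  -- Simple reflections are involutions, so words in I already form a subgroup.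
  InParabolic : Subset r → W → Set (m ⊔ ℓm)
  InParabolic I x = ∃ λ R → All (_∈ I) R × eval R ≈ʷ x

  IsLongestElement : Subset r → W → Set (m ⊔ ℓm)
  IsLongestElement I x = InParabolic I x × (∀ y → InParabolic I y → y ≤ℓ x)

  -- Edges of the Dynkin diagram, without multiplicities.
  Adjacent : Rel (Fin r) ℓ₁
  Adjacent i j = i ≢ j × ¬ (⟨ simpleRoot i , simpleRoot j ⟩ ≈ 0#)

  InducedEdge : Subset r → Rel (Fin r) ℓ₁
  InducedEdge I i j = i ∈ I × j ∈ I × Adjacent i j

  IsComponent : Subset r → Subset r → Set ℓ₁
  IsComponent I C = ∃ λ i → i ∈ I × (∀ j → j ∈ C ⇔ (j ∈ I × Star (InducedEdge I) i j))

  #letter : Fin r → Word → ℕ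
  #letter j R = length (filter (_≟ j) R)

  #letters : Subset r → Word → ℕ
  #letters C R = length (filter (_∈? C) R)

  record IsWitness (I : Subset r) (w : W) (R : Word) : Set (ℓ₁ ⊔ m ⊔ ℓm) where
    field
      reducedExpression : IsReducedExpression R w
      outside           : ∀ j → j ∉ I → #letter j R ℕ.≤ 1
      components        : ∀ C → IsComponent I C →
                          ∃₂ λ x k → IsLongestElement C x × HasLength x k ×
                                     #letters C R ℕ.≤ k ℕ.+ ∣ C ∣

  IsSpherical : Subset r → W → Set (ℓ₁ ⊔ m ⊔ ℓm)
  IsSpherical I w = ∃ λ R → IsWitness I w R

{-# OPTIONS --safe #-}
module Submission where

-- Peel off left descents in I, one at a time: if s_j lowers the length of v = s_{i₁} ⋯ s_{iₙ},
-- then α_j is turned into a simple root α_i by undoing a prefix s_{i₁} ⋯ s_{iₜ₋₁} with iₜ = i,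
-- and s_j v is obtained by deleting the letter iₜ.  The letters outside I occur at most once, so a
-- nonzero coordinate of the travelling root at such a letter could never disappear again; hence
-- the root stays supported on the component of j in I, and i lies in that component.  So moving j
-- to the front in exchange for iₜ raises no count of a witness.  When no descent in I
-- is left, the letters moved to the front spell an element u of W_I, and I ⊆ J(w) forces u⁻¹ to
-- make every α_j with j ∈ I negative: u is w₀(I), and it is an involution.

open import Defs
open import Algebra.Bundles using (CommutativeRing; AbelianGroup)
import Algebra.Definitions.RawMonoid as RawMonoidDefs
import Algebra.Properties.AbelianGroup as AbelianGroupProperties
import Algebra.Properties.CommutativeMonoid.Sum as Sum
import Algebra.Properties.CommutativeSemigroup as CommutativeSemigroupProperties
import Algebra.Solver.CommutativeMonoid as MonoidSolver
open import Algebra.Module.Bundles using (LeftModule)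
open import Data.Empty using (⊥; ⊥-elim)
open import Data.Fin.Base using (Fin; zero; suc)
open import Data.Fin.Properties using (_≟_; any?)
open import Data.Fin.Subset using (Subset; _∈_; _∉_)
open import Data.Fin.Subset.Properties using (_∈?_)
open import Data.List.Base using (List; []; _∷_; _++_; length; filter)
open import Data.List.Properties using (filter-++; filter-accept; length-++)
open import Data.List.Relation.Unary.All using (All; []; _∷_)
import Data.List.Relation.Unary.All as All
import Data.List.Relation.Unary.All.Properties as All
open import Data.Nat.Base as ℕ using (ℕ)
import Data.Nat.Properties as ℕ
open import Data.Product.Base using (∃; ∃₂; _×_; _,_; proj₁)
open import Data.Sum.Base using (_⊎_; inj₁; inj₂)
open import Function.Base using (_∘_; case_of_)
open import Function.Bundles using (Equivalence)
open import Level using (Level; _⊔_)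
open import Relation.Binary.Construct.Closure.ReflexiveTransitive
  using (Star; _◅_; _◅◅_) renaming (ε to ε★)
open import Relation.Binary.PropositionalEquality using
  (_≡_; _≢_; refl; sym; trans; cong; subst; module ≡-Reasoning)
import Relation.Binary.Reasoning.Setoid as SetoidReasoning
open import Relation.Binary.Structures using (IsStrictTotalOrder)
open import Relation.Unary using (Decidable)
open import Relation.Nullary using (¬_; Dec; yes; no; _×-dec_)

-- Signs in an ordered field.

module OrderedFieldProperties {c ℓ₁ ℓ₂} (K : OrderedField c ℓ₁ ℓ₂) where
  open OrderedField K
  open CommutativeRing commutativeRing public
    using ( setoid; +-cong; +-congˡ; +-congʳ; +-comm; +-identityˡ; +-identityʳ; -‿cong; -‿inverseʳ
          ; *-cong; *-congˡ; *-congʳ; *-assoc; *-comm; *-identityʳ; zeroˡ; zeroʳ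
          ; distribˡ; distribʳ; *-commutativeMonoid; *-commutativeSemigroup; +-abelianGroup )
    renaming (refl to ≈-refl; reflexive to ≈-reflexive; sym to ≈-sym; trans to ≈-trans)
  open RawMonoidDefs +-rawMonoid public using () renaming (_×_ to _×#_)
  open AbelianGroupProperties +-abelianGroup public
    using () renaming ( inverseˡ-unique to +-inverseˡ-unique; x∙y⁻¹≈ε⇒x≈y to x+-y≈0⇒x≈y
                      ; ε⁻¹≈ε to -0≈0 )
  open IsStrictTotalOrder isStrictTotalOrder public
    using (<-respˡ-≈; <-respʳ-≈)
    renaming (irrefl to <-irrefl; trans to <-trans; _≟_ to _≈?_)

  infix 4 0≤_
  0≤_ : Carrier → Set (ℓ₁ ⊔ ℓ₂)
  0≤ x = 0# < x ⊎ x ≈ 0#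

  0≤-resp-≈ : ∀ {x y} → x ≈ y → 0≤ x → 0≤ y
  0≤-resp-≈ x≈y (inj₁ 0<x) = inj₁ (<-respʳ-≈ x≈y 0<x)
  0≤-resp-≈ x≈y (inj₂ x≈0) = inj₂ (≈-trans (≈-sym x≈y) x≈0)

  +-pos-nonneg : ∀ {x y} → 0# < x → 0≤ y → 0# < x + y
  +-pos-nonneg {x} {y} 0<x (inj₁ 0<y) =
    <-trans 0<y (<-respˡ-≈ (+-identityˡ y) (+-monoˡ-< y 0<x))
  +-pos-nonneg {x} {y} 0<x (inj₂ y≈0) =
    <-respʳ-≈ (≈-sym (≈-trans (+-congˡ y≈0) (+-identityʳ x))) 0<x

  +-nonneg : ∀ {x y} → 0≤ x → 0≤ y → 0≤ (x + y)
  +-nonneg (inj₁ 0<x) 0≤y = inj₁ (+-pos-nonneg 0<x 0≤y)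
  +-nonneg {x} {y} (inj₂ x≈0) 0≤y =
    0≤-resp-≈ (≈-sym (≈-trans (+-congʳ x≈0) (+-identityˡ y))) 0≤y

  *-nonneg : ∀ {x y} → 0≤ x → 0≤ y → 0≤ (x * y)
  *-nonneg (inj₁ 0<x) (inj₁ 0<y) = inj₁ (*-pos 0<x 0<y)
  *-nonneg (inj₂ x≈0) _          = inj₂ (≈-trans (*-congʳ x≈0) (zeroˡ _))
  *-nonneg _          (inj₂ y≈0) = inj₂ (≈-trans (*-congˡ y≈0) (zeroʳ _))

  ×-nonneg : ∀ n → 0≤ (n ×# 1#)
  ×-nonneg ℕ.zero    = inj₂ ≈-refl
  ×-nonneg (ℕ.suc n) = +-nonneg (inj₁ 0<1) (×-nonneg n)

  -- If `x` were strictly positive, so would be the sum. Applied coordinatewise, this turns opposite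
  -- signs of a vector into vanishing coordinates.
  nonneg-+≈0⇒≈0 : ∀ {x y} → 0≤ x → 0≤ y → x + y ≈ 0# → x ≈ 0#
  nonneg-+≈0⇒≈0 (inj₁ 0<x) 0≤y x+y≈0 = ⊥-elim (<-irrefl (≈-sym x+y≈0) (+-pos-nonneg 0<x 0≤y))
  nonneg-+≈0⇒≈0 (inj₂ x≈0) _   _     = x≈0

  1≉0 : ¬ (1# ≈ 0#)
  1≉0 1≈0 = <-irrefl (≈-sym 1≈0) 0<1

-- Linear maps, reflections and finite sums in a Euclidean space.

module EuclideanSpaceProperties {c ℓ₁ ℓ₂ m ℓm} {K : OrderedField c ℓ₁ ℓ₂}
                                (E : EuclideanSpace K m ℓm) where
  open OrderedField K
  open OrderedFieldProperties K
  open EuclideanSpace E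
  open LeftModule leftModule public
    using ( ≈ᴹ-setoid; ≈ᴹ-refl; ≈ᴹ-reflexive; ≈ᴹ-sym; ≈ᴹ-trans; +ᴹ-cong; +ᴹ-congˡ; +ᴹ-congʳ; +ᴹ-assoc; +ᴹ-comm
          ; +ᴹ-identityˡ; +ᴹ-identityʳ; -ᴹ‿cong; -ᴹ‿inverseˡ; -ᴹ‿inverseʳ; *ₗ-cong; *ₗ-congˡ; *ₗ-congʳ
          ; *ₗ-zeroˡ; *ₗ-zeroʳ; *ₗ-distribˡ; *ₗ-distribʳ; *ₗ-identityˡ; *ₗ-assoc
          ; +ᴹ-abelianGroup; +ᴹ-commutativeMonoid )
  open AbelianGroupProperties +ᴹ-abelianGroup public
    using () renaming ( inverseˡ-unique to inverseˡ-uniqueᴹ; ⁻¹-involutive to -ᴹ-involutive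
                      ; ⁻¹-∙-comm to -ᴹ‿+-comm )
  open CommutativeSemigroupProperties (AbelianGroup.commutativeSemigroup +ᴹ-abelianGroup)
    using () renaming (interchange to +ᴹ-interchange)
  open Sum +ᴹ-commutativeMonoid public using (sum-cong-≋; ∑-distrib-+)
  open CommutativeSemigroupProperties *-commutativeSemigroup using (x∙yz≈y∙xz)

  -ᴹ‿*ₗ : ∀ x v → -ᴹ (x *ₗ v) ≈ᴹ (- x) *ₗ v
  -ᴹ‿*ₗ x v = ≈ᴹ-sym (inverseˡ-uniqueᴹ _ _ (begin
    (- x) *ₗ v +ᴹ x *ₗ v  ≈⟨ *ₗ-distribʳ v (- x) x ⟨
    (- x + x) *ₗ v        ≈⟨ *ₗ-congʳ (≈-trans (+-comm _ _) (-‿inverseʳ x)) ⟩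
    0# *ₗ v               ≈⟨ *ₗ-zeroˡ v ⟩
    0ᴹ                    ∎))
    where open SetoidReasoning ≈ᴹ-setoid

  record Linear (f : Carrierᴹ → Carrierᴹ) : Set (c ⊔ m ⊔ ℓm) where
    field
      resp-≈ : ∀ {u v} → u ≈ᴹ v → f u ≈ᴹ f v
      homo-+ : ∀ u v → f (u +ᴹ v) ≈ᴹ f u +ᴹ f v
      homo-* : ∀ x v → f (x *ₗ v) ≈ᴹ x *ₗ f v

    homo-0 : f 0ᴹ ≈ᴹ 0ᴹ
    homo-0 = begin
      f 0ᴹ          ≈⟨ resp-≈ (*ₗ-zeroˡ 0ᴹ) ⟨
      f (0# *ₗ 0ᴹ)  ≈⟨ homo-* 0# 0ᴹ ⟩
      0# *ₗ f 0ᴹ    ≈⟨ *ₗ-zeroˡ (f 0ᴹ) ⟩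
      0ᴹ            ∎
      where open SetoidReasoning ≈ᴹ-setoid

    homo-neg : ∀ v → f (-ᴹ v) ≈ᴹ -ᴹ (f v)
    homo-neg v = inverseˡ-uniqueᴹ _ _ (begin
      f (-ᴹ v) +ᴹ f v  ≈⟨ homo-+ (-ᴹ v) v ⟨
      f (-ᴹ v +ᴹ v)    ≈⟨ resp-≈ (-ᴹ‿inverseˡ v) ⟩
      f 0ᴹ             ≈⟨ homo-0 ⟩
      0ᴹ               ∎)
      where open SetoidReasoning ≈ᴹ-setoid

  id-linear : Linear (λ v → v)
  id-linear = record { resp-≈ = λ eq → eq ; homo-+ = λ _ _ → ≈ᴹ-refl ; homo-* = λ _ _ → ≈ᴹ-refl }

  ∘-linear : ∀ {f g} → Linear f → Linear g → Linear (f ∘ g)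
  ∘-linear lf lg = record
    { resp-≈ = λ eq → F.resp-≈ (G.resp-≈ eq)
    ; homo-+ = λ u v → ≈ᴹ-trans (F.resp-≈ (G.homo-+ u v)) (F.homo-+ _ _)
    ; homo-* = λ x v → ≈ᴹ-trans (F.resp-≈ (G.homo-* x v)) (F.homo-* _ _)
    }
    where module F = Linear lf
          module G = Linear lg

  neg-linear : Linear -ᴹ_
  neg-linear = record
    { resp-≈ = -ᴹ‿cong
    ; homo-+ = λ u v → ≈ᴹ-sym (-ᴹ‿+-comm u v)
    ; homo-* = λ x v → inverse-* x v
    }
    where
    inverse-* : ∀ x v → -ᴹ (x *ₗ v) ≈ᴹ x *ₗ (-ᴹ v)
    inverse-* x v = ≈ᴹ-sym (inverseˡ-uniqueᴹ _ _
      (≈ᴹ-trans (≈ᴹ-sym (*ₗ-distribˡ x (-ᴹ v) v))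
      (≈ᴹ-trans (*ₗ-congˡ (-ᴹ‿inverseˡ v)) (*ₗ-zeroʳ x))))

  scale-linear : ∀ a → Linear (a *ₗ_)
  scale-linear a = record
    { resp-≈ = *ₗ-congˡ
    ; homo-+ = *ₗ-distribˡ a
    ; homo-* = λ x v → ≈ᴹ-trans (≈ᴹ-sym (*ₗ-assoc a x v))
                       (≈ᴹ-trans (*ₗ-congʳ (*-comm a x)) (*ₗ-assoc x a v))
    }

  cartan-congˡ : ∀ {u v} α → u ≈ᴹ v → cartan u α ≈ cartan v α
  cartan-congˡ α u≈v = *-congʳ (*-congˡ (⟨,⟩-cong u≈v ≈ᴹ-refl))

  cartan-+ : ∀ α u v → cartan (u +ᴹ v) α ≈ cartan u α + cartan v α
  cartan-+ α u v = begin
    2# * ⟨ u +ᴹ v , α ⟩ * n                ≈⟨ *-congʳ (*-congˡ (⟨,⟩-+ˡ u v α)) ⟩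
    2# * (⟨ u , α ⟩ + ⟨ v , α ⟩) * n       ≈⟨ *-congʳ (distribˡ 2# _ _) ⟩
    (2# * ⟨ u , α ⟩ + 2# * ⟨ v , α ⟩) * n  ≈⟨ distribʳ n _ _ ⟩
    cartan u α + cartan v α                ∎
    where open SetoidReasoning setoid
          2# = 1# + 1#
          n = ⟨ α , α ⟩ ⁻¹

  cartan-* : ∀ α x v → cartan (x *ₗ v) α ≈ x * cartan v α
  cartan-* α x v = begin
    2# * ⟨ x *ₗ v , α ⟩ * n    ≈⟨ *-congʳ (*-congˡ (⟨,⟩-*ˡ x v α)) ⟩
    2# * (x * ⟨ v , α ⟩) * n   ≈⟨ *-congʳ (x∙yz≈y∙xz 2# x _) ⟩
    x * (2# * ⟨ v , α ⟩) * n   ≈⟨ *-assoc x _ n ⟩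
    x * cartan v α             ∎
    where open SetoidReasoning setoid
          2# = 1# + 1#
          n = ⟨ α , α ⟩ ⁻¹

  reflect-linear : ∀ α → Linear (reflect α)
  reflect-linear α = record
    { resp-≈ = λ u≈v → +ᴹ-cong u≈v (-ᴹ‿cong (*ₗ-congʳ (cartan-congˡ α u≈v)))
    ; homo-+ = λ u v → begin
        (u +ᴹ v) +ᴹ -ᴹ (cartan (u +ᴹ v) α *ₗ α)
          ≈⟨ +ᴹ-congˡ (-ᴹ‿cong (≈ᴹ-trans (*ₗ-congʳ (cartan-+ α u v)) (*ₗ-distribʳ α _ _))) ⟩
        (u +ᴹ v) +ᴹ -ᴹ (cartan u α *ₗ α +ᴹ cartan v α *ₗ α)
          ≈⟨ +ᴹ-congˡ (-ᴹ‿+-comm _ _) ⟨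
        (u +ᴹ v) +ᴹ (-ᴹ (cartan u α *ₗ α) +ᴹ -ᴹ (cartan v α *ₗ α))
          ≈⟨ +ᴹ-interchange u v _ _ ⟩
        reflect α u +ᴹ reflect α v ∎
    ; homo-* = λ x v → begin
        x *ₗ v +ᴹ -ᴹ (cartan (x *ₗ v) α *ₗ α)
          ≈⟨ +ᴹ-congˡ (-ᴹ‿cong (≈ᴹ-trans (*ₗ-congʳ (cartan-* α x v)) (*ₗ-assoc x _ α))) ⟩
        x *ₗ v +ᴹ -ᴹ (x *ₗ (cartan v α *ₗ α))
          ≈⟨ +ᴹ-congˡ (Linear.homo-* neg-linear x _) ⟩
        x *ₗ v +ᴹ x *ₗ -ᴹ (cartan v α *ₗ α)
          ≈⟨ *ₗ-distribˡ x v _ ⟨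
        x *ₗ reflect α v ∎
    }
    where open SetoidReasoning ≈ᴹ-setoid

  ⟨,⟩-0ˡ : ∀ v → ⟨ 0ᴹ , v ⟩ ≈ 0#
  ⟨,⟩-0ˡ v = ≈-trans (⟨,⟩-cong (≈ᴹ-sym (*ₗ-zeroˡ 0ᴹ)) ≈ᴹ-refl)
                     (≈-trans (⟨,⟩-*ˡ 0# 0ᴹ v) (zeroˡ _))

  ⟨,⟩-negˡ : ∀ u v → ⟨ -ᴹ u , v ⟩ ≈ - ⟨ u , v ⟩
  ⟨,⟩-negˡ u v = +-inverseˡ-unique _ _ (begin
    ⟨ -ᴹ u , v ⟩ + ⟨ u , v ⟩  ≈⟨ ⟨,⟩-+ˡ (-ᴹ u) u v ⟨
    ⟨ -ᴹ u +ᴹ u , v ⟩         ≈⟨ ⟨,⟩-cong (-ᴹ‿inverseˡ u) ≈ᴹ-refl ⟩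
    ⟨ 0ᴹ , v ⟩                ≈⟨ ⟨,⟩-0ˡ v ⟩
    0#                        ∎)
    where open SetoidReasoning setoid

  ⟨,⟩-reflectˡ : ∀ α u v → ⟨ reflect α u , v ⟩ ≈ ⟨ u , v ⟩ + - (cartan u α * ⟨ α , v ⟩)
  ⟨,⟩-reflectˡ α u v = begin
    ⟨ reflect α u , v ⟩                        ≈⟨ ⟨,⟩-+ˡ u _ v ⟩
    ⟨ u , v ⟩ + ⟨ -ᴹ (cartan u α *ₗ α) , v ⟩   ≈⟨ +-congˡ (⟨,⟩-negˡ _ v) ⟩
    ⟨ u , v ⟩ + - ⟨ cartan u α *ₗ α , v ⟩      ≈⟨ +-congˡ (-‿cong (⟨,⟩-*ˡ _ α v)) ⟩
    ⟨ u , v ⟩ + - (cartan u α * ⟨ α , v ⟩)     ∎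
    where open SetoidReasoning setoid

  -- The correction term 2⟨u,α⟩⟨α,v⟩⟨α,α⟩⁻¹ is symmetric in `u` and `v`.
  reflect-adjoint : ∀ α u v → ⟨ reflect α u , v ⟩ ≈ ⟨ u , reflect α v ⟩
  reflect-adjoint α u v = begin
    ⟨ reflect α u , v ⟩                      ≈⟨ ⟨,⟩-reflectˡ α u v ⟩
    ⟨ u , v ⟩ + - (cartan u α * ⟨ α , v ⟩)   ≈⟨ +-cong (⟨,⟩-sym u v) (-‿cong swap) ⟩
    ⟨ v , u ⟩ + - (cartan v α * ⟨ α , u ⟩)   ≈⟨ ⟨,⟩-reflectˡ α v u ⟨
    ⟨ reflect α v , u ⟩                      ≈⟨ ⟨,⟩-sym _ _ ⟩
    ⟨ u , reflect α v ⟩                      ∎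
    where
    open SetoidReasoning setoid
    open MonoidSolver *-commutativeMonoid using (solve; _⊕_; _⊜_)
    swap : cartan u α * ⟨ α , v ⟩ ≈ cartan v α * ⟨ α , u ⟩
    swap = ≈-trans (*-cong (*-congʳ (*-congˡ (⟨,⟩-sym u α))) (⟨,⟩-sym α v))
                   (solve 4 (λ a b n d → ((a ⊕ b) ⊕ n) ⊕ d ⊜ ((a ⊕ d) ⊕ n) ⊕ b) ≈-refl
                     (1# + 1#) ⟨ α , u ⟩ (⟨ α , α ⟩ ⁻¹) ⟨ v , α ⟩)

  ⟨v,v⟩≉0 : ∀ {v} → ¬ (v ≈ᴹ 0ᴹ) → ¬ (⟨ v , v ⟩ ≈ 0#)
  ⟨v,v⟩≉0 v≉0 vv≈0 = <-irrefl (≈-sym vv≈0) (positiveDefinite _ v≉0)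

  cartan-self : ∀ {α} → ¬ (α ≈ᴹ 0ᴹ) → cartan α α ≈ 1# + 1#
  cartan-self {α} α≉0 = begin
    (1# + 1#) * ⟨ α , α ⟩ * ⟨ α , α ⟩ ⁻¹    ≈⟨ *-assoc _ _ _ ⟩
    (1# + 1#) * (⟨ α , α ⟩ * ⟨ α , α ⟩ ⁻¹)  ≈⟨ *-congˡ (*-inverseʳ _ (⟨v,v⟩≉0 α≉0)) ⟩
    (1# + 1#) * 1#                          ≈⟨ *-identityʳ _ ⟩
    1# + 1#                                 ∎
    where open SetoidReasoning setoid

  reflect-self : ∀ {α} → ¬ (α ≈ᴹ 0ᴹ) → reflect α α ≈ᴹ -ᴹ α
  reflect-self {α} α≉0 = inverseˡ-uniqueᴹ _ _ (begin
    (α +ᴹ -ᴹ (cartan α α *ₗ α)) +ᴹ α    ≈⟨ +ᴹ-comm _ _ ⟩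
    α +ᴹ (α +ᴹ -ᴹ (cartan α α *ₗ α))    ≈⟨ +ᴹ-assoc _ _ _ ⟨
    (α +ᴹ α) +ᴹ -ᴹ (cartan α α *ₗ α)    ≈⟨ +ᴹ-congˡ (-ᴹ‿cong (*ₗ-congʳ (cartan-self α≉0))) ⟩
    (α +ᴹ α) +ᴹ -ᴹ ((1# + 1#) *ₗ α)     ≈⟨ +ᴹ-congˡ (-ᴹ‿cong (*ₗ-distribʳ α 1# 1#)) ⟩
    (α +ᴹ α) +ᴹ -ᴹ (1# *ₗ α +ᴹ 1# *ₗ α) ≈⟨ +ᴹ-congˡ (-ᴹ‿cong (+ᴹ-cong (*ₗ-identityˡ α) (*ₗ-identityˡ α))) ⟩
    (α +ᴹ α) +ᴹ -ᴹ (α +ᴹ α)             ≈⟨ -ᴹ‿inverseʳ _ ⟩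
    0ᴹ                                  ∎)
    where open SetoidReasoning ≈ᴹ-setoid

  reflect-involutive : ∀ {α} → ¬ (α ≈ᴹ 0ᴹ) → ∀ v → reflect α (reflect α v) ≈ᴹ v
  reflect-involutive {α} α≉0 v = begin
    reflect α (v +ᴹ -ᴹ w)            ≈⟨ L.homo-+ v (-ᴹ w) ⟩
    reflect α v +ᴹ reflect α (-ᴹ w)  ≈⟨ +ᴹ-congˡ (L.homo-neg w) ⟩
    reflect α v +ᴹ -ᴹ (reflect α w)  ≈⟨ +ᴹ-congˡ (-ᴹ‿cong (L.homo-* _ α)) ⟩
    reflect α v +ᴹ -ᴹ (cartan v α *ₗ reflect α α)
                                     ≈⟨ +ᴹ-congˡ (-ᴹ‿cong (*ₗ-congˡ (reflect-self α≉0))) ⟩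
    reflect α v +ᴹ -ᴹ (cartan v α *ₗ -ᴹ α)
                                     ≈⟨ +ᴹ-congˡ (-ᴹ‿cong (Linear.homo-* neg-linear _ α)) ⟨
    reflect α v +ᴹ -ᴹ (-ᴹ w)         ≈⟨ +ᴹ-congˡ (-ᴹ-involutive w) ⟩
    (v +ᴹ -ᴹ w) +ᴹ w                 ≈⟨ +ᴹ-assoc _ _ _ ⟩
    v +ᴹ (-ᴹ w +ᴹ w)                 ≈⟨ +ᴹ-congˡ (-ᴹ‿inverseˡ w) ⟩
    v +ᴹ 0ᴹ                          ≈⟨ +ᴹ-identityʳ v ⟩
    v                                ∎
    where open SetoidReasoning ≈ᴹ-setoid
          module L = Linear (reflect-linear α)
          w = cartan v α *ₗ α

  reflect-congˡ : ∀ {α β} → α ≈ᴹ β → ∀ v → reflect α v ≈ᴹ reflect β v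
  reflect-congˡ α≈β v = +ᴹ-congˡ (-ᴹ‿cong (*ₗ-cong
    (*-cong (*-congˡ (⟨,⟩-cong ≈ᴹ-refl α≈β)) (⁻¹-cong (⟨,⟩-cong α≈β α≈β))) α≈β))

  -- Conjugating by `reflect α` carries the reflection in `β` to the one in `reflect α β`, since
  -- `reflect α` is an isometric involution. This form lets a reflection be pushed past a letter of
  -- a word.
  reflect-conjugate : ∀ {α} → ¬ (α ≈ᴹ 0ᴹ) → ∀ β v →
                      reflect β (reflect α v) ≈ᴹ reflect α (reflect (reflect α β) v)
  reflect-conjugate {α} α≉0 β v = ≈ᴹ-sym (begin
    reflect α (v +ᴹ -ᴹ (cartan v sβ *ₗ sβ))
      ≈⟨ L.homo-+ v _ ⟩
    reflect α v +ᴹ reflect α (-ᴹ (cartan v sβ *ₗ sβ))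
      ≈⟨ +ᴹ-congˡ (≈ᴹ-trans (L.homo-neg _) (-ᴹ‿cong (L.homo-* _ sβ))) ⟩
    reflect α v +ᴹ -ᴹ (cartan v sβ *ₗ reflect α sβ)
      ≈⟨ +ᴹ-congˡ (-ᴹ‿cong (*ₗ-cong cartan-sβ (reflect-involutive α≉0 β))) ⟩
    reflect β (reflect α v) ∎)
    where
    open SetoidReasoning ≈ᴹ-setoid
    module L = Linear (reflect-linear α)
    sβ = reflect α β
    cartan-sβ : cartan v sβ ≈ cartan (reflect α v) β
    cartan-sβ = *-cong (*-congˡ (≈-sym (reflect-adjoint α v β)))
      (⁻¹-cong (≈-trans (reflect-adjoint α β sβ)
                        (⟨,⟩-cong ≈ᴹ-refl (reflect-involutive α≉0 β))))

  linear-sum : ∀ {f} → Linear f → ∀ {n} (g : Fin n → Carrierᴹ) → f (sumᴹ g) ≈ᴹ sumᴹ (f ∘ g)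
  linear-sum lf {ℕ.zero}  g = Linear.homo-0 lf
  linear-sum lf {ℕ.suc n} g = ≈ᴹ-trans (Linear.homo-+ lf _ _) (+ᴹ-congˡ (linear-sum lf (g ∘ suc)))

  -- Kronecker delta, defined by recursion on both indices so that `sum-unit` follows by induction
  -- along the sum.
  unit : ∀ {n} → Fin n → Fin n → Carrier
  unit zero    zero    = 1#
  unit zero    (suc _) = 0#
  unit (suc _) zero    = 0#
  unit (suc k) (suc i) = unit k i

  unit-diag : ∀ {n} (k : Fin n) → unit k k ≡ 1#
  unit-diag zero    = refl
  unit-diag (suc k) = unit-diag k

  unit-off : ∀ {n} {k i : Fin n} → i ≢ k → unit k i ≡ 0#
  unit-off {k = zero}  {zero}  i≢k = ⊥-elim (i≢k refl)
  unit-off {k = zero}  {suc _} i≢k = refl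
  unit-off {k = suc _} {zero}  i≢k = refl
  unit-off {k = suc k} {suc i} i≢k = unit-off {k = k} {i} (λ { refl → i≢k refl })

  sum-zero : ∀ {n} (g : Fin n → Carrierᴹ) → sumᴹ (λ i → 0# *ₗ g i) ≈ᴹ 0ᴹ
  sum-zero {ℕ.zero}  g = ≈ᴹ-refl
  sum-zero {ℕ.suc n} g = ≈ᴹ-trans (+ᴹ-cong (*ₗ-zeroˡ _) (sum-zero (g ∘ suc))) (+ᴹ-identityˡ 0ᴹ)

  sum-unit : ∀ {n} (k : Fin n) (g : Fin n → Carrierᴹ) → sumᴹ (λ i → unit k i *ₗ g i) ≈ᴹ g k
  sum-unit zero    g = ≈ᴹ-trans (+ᴹ-cong (*ₗ-identityˡ _) (sum-zero (g ∘ suc))) (+ᴹ-identityʳ _)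
  sum-unit (suc k) g = ≈ᴹ-trans (+ᴹ-cong (*ₗ-zeroˡ _) (sum-unit k (g ∘ suc))) (+ᴹ-identityˡ _)

  -- Translates the natural multiples supplied by `signed` into the field coefficients used from
  -- here on.
  ×ᴹ-*ₗ : ∀ n v → n ×ᴹ v ≈ᴹ (n ×# 1#) *ₗ v
  ×ᴹ-*ₗ ℕ.zero    v = ≈ᴹ-sym (*ₗ-zeroˡ v)
  ×ᴹ-*ₗ (ℕ.suc n) v = ≈ᴹ-trans (+ᴹ-cong (≈ᴹ-sym (*ₗ-identityˡ v)) (×ᴹ-*ₗ n v))
                               (≈ᴹ-sym (*ₗ-distribʳ v 1# _))

-- Simple coordinates, signs of roots and supports.

module SimpleSystemProperties {c ℓ₁ ℓ₂ m ℓm} {K : OrderedField c ℓ₁ ℓ₂} {E : EuclideanSpace K m ℓm}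
                              {Φ : RootSystem E} {r : ℕ} (Δ : SimpleSystem Φ r) where
  open OrderedField K
  open OrderedFieldProperties K
  open EuclideanSpace E
  open EuclideanSpaceProperties E
  open RootSystem Φ
  open SimpleSystem Δ

  lin : (Fin r → Carrier) → Carrierᴹ
  lin x = sumᴹ (λ i → x i *ₗ simpleRoot i)

  lin-cong : ∀ {x y} → (∀ i → x i ≈ y i) → lin x ≈ᴹ lin y
  lin-cong x≈y = sum-cong-≋ (λ i → *ₗ-congʳ (x≈y i))

  lin-+ : ∀ x y → lin (λ i → x i + y i) ≈ᴹ lin x +ᴹ lin y
  lin-+ x y = ≈ᴹ-trans (sum-cong-≋ (λ i → *ₗ-distribʳ (simpleRoot i) (x i) (y i)))
    (∑-distrib-+ (λ i → x i *ₗ simpleRoot i) (λ i → y i *ₗ simpleRoot i))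

  lin-* : ∀ a x → lin (λ i → a * x i) ≈ᴹ a *ₗ lin x
  lin-* a x = ≈ᴹ-trans (sum-cong-≋ (λ i → *ₗ-assoc a (x i) (simpleRoot i)))
    (≈ᴹ-sym (linear-sum (scale-linear a) (λ i → x i *ₗ simpleRoot i)))

  lin-neg : ∀ x → lin (λ i → - x i) ≈ᴹ -ᴹ (lin x)
  lin-neg x = ≈ᴹ-trans (sum-cong-≋ (λ i → ≈ᴹ-sym (-ᴹ‿*ₗ (x i) (simpleRoot i))))
    (≈ᴹ-sym (linear-sum neg-linear (λ i → x i *ₗ simpleRoot i)))

  lin-unit : ∀ k → lin (unit k) ≈ᴹ simpleRoot k
  lin-unit k = sum-unit k simpleRoot

  lin-injective : ∀ {x y} → lin x ≈ᴹ lin y → ∀ i → x i ≈ y i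
  lin-injective {x} {y} eq i = x+-y≈0⇒x≈y _ _ (independent (λ i → x i + - y i)
    (≈ᴹ-trans (lin-+ x (λ i → - y i))
    (≈ᴹ-trans (+ᴹ-cong eq (lin-neg y)) (-ᴹ‿inverseʳ (lin y)))) i)

  reflect-lin : ∀ k x → reflect (simpleRoot k) (lin x)
                      ≈ᴹ lin (λ i → x i + (- cartan (lin x) (simpleRoot k)) * unit k i)
  reflect-lin k x = ≈ᴹ-sym (≈ᴹ-trans (lin-+ x _) (+ᴹ-congˡ
    (≈ᴹ-trans (lin-* _ (unit k)) (≈ᴹ-trans (*ₗ-congˡ (lin-unit k)) (≈ᴹ-sym (-ᴹ‿*ₗ _ _))))))

  -- A simple reflection subtracts a multiple of its own simple root, so it can alter only the
  -- `k`-th coordinate.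
  reflect-lin-off : ∀ {k i : Fin r} → i ≢ k → ∀ x a → x + a * unit k i ≈ x
  reflect-lin-off {k} {i} i≢k x a rewrite unit-off {k = k} {i} i≢k =
    ≈-trans (+-congˡ (zeroʳ a)) (+-identityʳ x)

  -- Both cones contain `0ᴹ`, so they exclude each other only on nonzero vectors such as roots.
  -- Field coefficients keep them closed under nonnegative scaling.
  Pos Neg : Carrierᴹ → Set (c ⊔ ℓ₁ ⊔ ℓ₂ ⊔ ℓm)
  Pos v = ∃ λ x → (∀ i → 0≤ x i) × v ≈ᴹ lin x
  Neg v = Pos (-ᴹ v)

  Supported : Subset r → Carrierᴹ → Set (c ⊔ ℓ₁ ⊔ ℓm)
  Supported D v = ∃ λ x → (∀ i → i ∉ D → x i ≈ 0#) × v ≈ᴹ lin x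

  Pos-resp-≈ : ∀ {u v} → u ≈ᴹ v → Pos u → Pos v
  Pos-resp-≈ u≈v (x , 0≤x , u≈x) = x , 0≤x , ≈ᴹ-trans (≈ᴹ-sym u≈v) u≈x

  Neg-resp-≈ : ∀ {u v} → u ≈ᴹ v → Neg u → Neg v
  Neg-resp-≈ u≈v = Pos-resp-≈ (-ᴹ‿cong u≈v)

  Pos-0 : Pos 0ᴹ
  Pos-0 = (λ _ → 0#) , (λ _ → inj₂ ≈-refl) , ≈ᴹ-sym (sum-zero simpleRoot)

  Pos-+ : ∀ {u v} → Pos u → Pos v → Pos (u +ᴹ v)
  Pos-+ (x , 0≤x , u≈x) (y , 0≤y , v≈y) =
    (λ i → x i + y i) , (λ i → +-nonneg (0≤x i) (0≤y i)) ,
    ≈ᴹ-trans (+ᴹ-cong u≈x v≈y) (≈ᴹ-sym (lin-+ x y))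

  Pos-* : ∀ {a v} → 0≤ a → Pos v → Pos (a *ₗ v)
  Pos-* {a} 0≤a (x , 0≤x , v≈x) =
    (λ i → a * x i) , (λ i → *-nonneg 0≤a (0≤x i)) ,
    ≈ᴹ-trans (*ₗ-congˡ v≈x) (≈ᴹ-sym (lin-* a x))

  Pos-sum : ∀ {n} {g : Fin n → Carrierᴹ} → (∀ i → Pos (g i)) → Pos (sumᴹ g)
  Pos-sum {ℕ.zero}  _   = Pos-0
  Pos-sum {ℕ.suc n} pos = Pos-+ (pos zero) (Pos-sum (pos ∘ suc))

  Pos-simple : ∀ k → Pos (simpleRoot k)
  Pos-simple k = unit k , nonneg k , ≈ᴹ-sym (lin-unit k)
    where
    nonneg : ∀ {n} (k i : Fin n) → 0≤ unit k i
    nonneg zero    zero    = inj₁ 0<1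
    nonneg zero    (suc _) = inj₂ ≈-refl
    nonneg (suc _) zero    = inj₂ ≈-refl
    nonneg (suc k) (suc i) = nonneg k i

  Supported-simple : ∀ {D k} → k ∈ D → Supported D (simpleRoot k)
  Supported-simple {D} {k} k∈D = unit k , off , ≈ᴹ-sym (lin-unit k)
    where
    off : ∀ i → i ∉ D → unit k i ≈ 0#
    off i i∉D rewrite unit-off {k = k} {i} (λ { refl → i∉D k∈D }) = ≈-refl

  Pos-Neg⇒≈0 : ∀ {v} → Pos v → Neg v → v ≈ᴹ 0ᴹ
  Pos-Neg⇒≈0 {v} (x , 0≤x , v≈x) (y , 0≤y , -v≈y) = begin
    v              ≈⟨ v≈x ⟩
    lin x          ≈⟨ lin-cong (λ i → nonneg-+≈0⇒≈0 (0≤x i) (0≤y i) (independent _ sum≈0 i)) ⟩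
    lin (λ _ → 0#) ≈⟨ sum-zero simpleRoot ⟩
    0ᴹ             ∎
    where
    open SetoidReasoning ≈ᴹ-setoid
    sum≈0 : lin (λ i → x i + y i) ≈ᴹ 0ᴹ
    sum≈0 = begin
      lin (λ i → x i + y i)  ≈⟨ lin-+ x y ⟩
      lin x +ᴹ lin y         ≈⟨ +ᴹ-cong v≈x -v≈y ⟨
      v +ᴹ -ᴹ v              ≈⟨ -ᴹ‿inverseʳ v ⟩
      0ᴹ                     ∎

  -- Expand `f v` along the simple roots. The coordinates showing positivity and those showing the
  -- support agree by independence, so only terms with index in `D` survive, and each of these is a
  -- nonnegative multiple of a positive vector.
  linear-Pos : ∀ {f D v} → Linear f → (∀ i → i ∈ D → Pos (f (simpleRoot i))) →
               Supported D v → Pos v → Pos (f v)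
  linear-Pos {f} {D} {v} lf f-pos (y , y-off , v≈y) (x , 0≤x , v≈x) =
    Pos-resp-≈ (≈ᴹ-sym (≈ᴹ-trans (Linear.resp-≈ lf v≈x)
                                 (linear-sum lf (λ i → x i *ₗ simpleRoot i))))
               (Pos-sum term)
    where
    term : ∀ i → Pos (f (x i *ₗ simpleRoot i))
    term i with i ∈? D
    ... | yes i∈D = Pos-resp-≈ (≈ᴹ-sym (Linear.homo-* lf _ _)) (Pos-* (0≤x i) (f-pos i i∈D))
    ... | no  i∉D = Pos-resp-≈ (≈ᴹ-sym (≈ᴹ-trans (Linear.homo-* lf _ _)
                      (≈ᴹ-trans (*ₗ-congʳ (≈-trans (x≈y i) (y-off i i∉D))) (*ₗ-zeroˡ _)))) Pos-0
      where x≈y = lin-injective (≈ᴹ-trans (≈ᴹ-sym v≈x) v≈y)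

  IsRoot : Carrierᴹ → Set ℓm
  IsRoot v = ∃ λ a → v ≈ᴹ root a

  simple-isRoot : ∀ k → IsRoot (simpleRoot k)
  simple-isRoot k = simple k , ≈ᴹ-refl

  simple≉0 : ∀ k → ¬ (simpleRoot k ≈ᴹ 0ᴹ)
  simple≉0 k = nonzero (simple k)

  reflect-isRoot : ∀ k {v} → IsRoot v → IsRoot (reflect (simpleRoot k) v)
  reflect-isRoot k (a , v≈a) with d , eq ← reflectionClosed (simple k) a =
    d , ≈ᴹ-trans (Linear.resp-≈ (reflect-linear (simpleRoot k)) v≈a) eq

  root-sign : ∀ {v} → IsRoot v → Pos v ⊎ Neg v
  root-sign (a , v≈a) with signed a
  ... | n , inj₁ eq = inj₁ (_ , (λ i → ×-nonneg (n i)) ,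
                            ≈ᴹ-trans v≈a (≈ᴹ-trans eq (sum-cong-≋ (λ i → ×ᴹ-*ₗ (n i) _))))
  ... | n , inj₂ eq = inj₂ (_ , (λ i → ×-nonneg (n i)) ,
                            ≈ᴹ-trans (-ᴹ‿cong (≈ᴹ-trans v≈a eq))
                            (≈ᴹ-trans (-ᴹ-involutive _) (sum-cong-≋ (λ i → ×ᴹ-*ₗ (n i) _))))

  ¬Pos×Neg : ∀ {v} → IsRoot v → Pos v → Neg v → ⊥
  ¬Pos×Neg (a , v≈a) pos neg = nonzero a (≈ᴹ-trans (≈ᴹ-sym v≈a) (Pos-Neg⇒≈0 pos neg))

  -- Off `k`, the reflection keeps every coordinate of `v`; these are nonnegative before it and
  -- nonpositive after it, hence zero. So `v` is a multiple of the `k`-th simple root, `reduced`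
  -- leaves a sign, and positivity decides it.
  Pos-flipped⇒simple : ∀ k {v} → IsRoot v → Pos v → Neg (reflect (simpleRoot k) v) →
                       v ≈ᴹ simpleRoot k
  Pos-flipped⇒simple k {v} v-root@(b , v≈b) pos@(x , 0≤x , v≈x) (y , 0≤y , -sv≈y) =
    case (reduced (simple k) b (x k) (≈ᴹ-trans (≈ᴹ-sym v≈b) v≈xₖα))
    where
    open SetoidReasoning ≈ᴹ-setoid
    α = simpleRoot k
    a = - cartan (lin x) α

    sum≈0 : lin (λ i → (x i + a * unit k i) + y i) ≈ᴹ 0ᴹ
    sum≈0 = begin
      lin (λ i → (x i + a * unit k i) + y i)    ≈⟨ lin-+ _ y ⟩
      lin (λ i → x i + a * unit k i) +ᴹ lin y   ≈⟨ +ᴹ-cong (reflect-lin k x) -sv≈y ⟨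
      reflect α (lin x) +ᴹ -ᴹ (reflect α v)     ≈⟨ +ᴹ-congʳ (Linear.resp-≈ (reflect-linear α) v≈x) ⟨
      reflect α v +ᴹ -ᴹ (reflect α v)           ≈⟨ -ᴹ‿inverseʳ _ ⟩
      0ᴹ                                        ∎

    off : ∀ i → i ≢ k → x i ≈ 0#
    off i i≢k = nonneg-+≈0⇒≈0 (0≤x i) (0≤y i)
      (≈-trans (+-congʳ (≈-sym (reflect-lin-off i≢k (x i) a))) (independent _ sum≈0 i))

    coordinates : ∀ i → x i ≈ x k * unit k i
    coordinates i with i ≟ k
    ... | yes refl rewrite unit-diag k       = ≈-sym (*-identityʳ (x k))
    ... | no  i≢k  rewrite unit-off {k = k} {i} i≢k = ≈-trans (off i i≢k) (≈-sym (zeroʳ (x k)))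

    v≈xₖα : v ≈ᴹ x k *ₗ α
    v≈xₖα = begin
      v                          ≈⟨ v≈x ⟩
      lin x                      ≈⟨ lin-cong coordinates ⟩
      lin (λ i → x k * unit k i) ≈⟨ lin-* (x k) (unit k) ⟩
      x k *ₗ lin (unit k)        ≈⟨ *ₗ-congˡ (lin-unit k) ⟩
      x k *ₗ α                   ∎

    case : root b ≈ᴹ α ⊎ root b ≈ᴹ -ᴹ α → v ≈ᴹ α
    case (inj₁ b≈α)  = ≈ᴹ-trans v≈b b≈α
    case (inj₂ b≈-α) = ⊥-elim (¬Pos×Neg v-root pos (Pos-resp-≈
      (≈ᴹ-sym (≈ᴹ-trans (-ᴹ‿cong (≈ᴹ-trans v≈b b≈-α)) (-ᴹ-involutive α))) (Pos-simple k)))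

  reflect-support : ∀ {D} k {x} → (∀ i → i ∉ D → x i ≈ 0#) →
                    (k ∉ D → x k + (- cartan (lin x) (simpleRoot k)) * unit k k ≈ 0#) →
                    Supported D (reflect (simpleRoot k) (lin x))
  reflect-support {D} k {x} off at-k = _ , off′ , reflect-lin k x
    where
    off′ : ∀ i → i ∉ D → x i + (- cartan (lin x) (simpleRoot k)) * unit k i ≈ 0#
    off′ i i∉D with i ≟ k
    ... | yes refl = at-k i∉D
    ... | no  i≢k  = ≈-trans (reflect-lin-off i≢k (x i) _) (off i i∉D)

  Supported-resp-≈ : ∀ {D u v} → u ≈ᴹ v → Supported D u → Supported D v
  Supported-resp-≈ u≈v (x , off , u≈x) = x , off , ≈ᴹ-trans (≈ᴹ-sym u≈v) u≈x

  Supported-reflect : ∀ {D k v} → k ∈ D → Supported D v → Supported D (reflect (simpleRoot k) v)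
  Supported-reflect {k = k} k∈D (x , off , v≈x) =
    Supported-resp-≈ (Linear.resp-≈ (reflect-linear (simpleRoot k)) (≈ᴹ-sym v≈x))
      (reflect-support k off (λ k∉D → ⊥-elim (k∉D k∈D)))

  ⟨sum,⟩≈0 : ∀ {n} {g : Fin n → Carrierᴹ} {v} → (∀ i → ⟨ g i , v ⟩ ≈ 0#) → ⟨ sumᴹ g , v ⟩ ≈ 0#
  ⟨sum,⟩≈0 {ℕ.zero}  _  = ⟨,⟩-0ˡ _
  ⟨sum,⟩≈0 {ℕ.suc n} eq = ≈-trans (⟨,⟩-+ˡ _ _ _)
    (≈-trans (+-cong (eq zero) (⟨sum,⟩≈0 (eq ∘ suc))) (+-identityˡ 0#))

  -- The `k`-th simple root is orthogonal to everything supported on `D`, so the coefficient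
  -- subtracted by the reflection vanishes.
  Supported-reflect-⊥ : ∀ {D k v} → (∀ i → i ∈ D → ⟨ simpleRoot i , simpleRoot k ⟩ ≈ 0#) →
                        Supported D v → Supported D (reflect (simpleRoot k) v)
  Supported-reflect-⊥ {D} {k} {v} orthogonal (x , off , v≈x) =
    Supported-resp-≈ (Linear.resp-≈ (reflect-linear α) (≈ᴹ-sym v≈x)) (reflect-support k off at-k)
    where
    open SetoidReasoning setoid
    α = simpleRoot k

    term : ∀ i → ⟨ x i *ₗ simpleRoot i , α ⟩ ≈ 0#
    term i with i ∈? D
    ... | yes i∈D = ≈-trans (⟨,⟩-*ˡ _ _ _) (≈-trans (*-congˡ (orthogonal i i∈D)) (zeroʳ _))
    ... | no  i∉D = ≈-trans (⟨,⟩-*ˡ _ _ _) (≈-trans (*-congʳ (off i i∉D)) (zeroˡ _))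

    cartan≈0 : cartan (lin x) α ≈ 0#
    cartan≈0 = ≈-trans (*-congʳ (≈-trans (*-congˡ (⟨sum,⟩≈0 term)) (zeroʳ _))) (zeroˡ _)

    at-k : k ∉ D → x k + (- cartan (lin x) α) * unit k k ≈ 0#
    at-k k∉D = begin
      x k + (- cartan (lin x) α) * unit k k  ≈⟨ +-cong (off k k∉D) (*-congʳ (-‿cong cartan≈0)) ⟩
      0# + (- 0#) * unit k k                 ≈⟨ +-identityˡ _ ⟩
      (- 0#) * unit k k                      ≈⟨ *-congʳ -0≈0 ⟩
      0# * unit k k                          ≈⟨ zeroˡ _ ⟩
      0#                                     ∎

  Supported-simple⇒∈ : ∀ {D i} → Supported D (simpleRoot i) → i ∈ D
  Supported-simple⇒∈ {D} {i} (x , off , αᵢ≈x) with i ∈? D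
  ... | yes i∈D = i∈D
  ... | no  i∉D = ⊥-elim (1≉0 1≈0)
    where
    1≈0 : 1# ≈ 0#
    1≈0 with eq ← lin-injective (≈ᴹ-trans (lin-unit i) αᵢ≈x) i
      rewrite unit-diag i = ≈-trans eq (off i i∉D)

-- Counting letters in a list.

module _ {a p} {A : Set a} {P : A → Set p} (P? : Decidable P) where

  private
    count : List A → ℕ
    count xs = length (filter P? xs)

  count-++ : ∀ xs ys → count (xs ++ ys) ≡ count xs ℕ.+ count ys
  count-++ xs ys = trans (cong length (filter-++ P? xs ys)) (length-++ (filter P? xs))

  count-∷-mono : ∀ x {xs ys} → count xs ℕ.≤ count ys → count (x ∷ xs) ℕ.≤ count (x ∷ ys)
  count-∷-mono x {xs} {ys} le
    rewrite count-++ (x ∷ []) xs | count-++ (x ∷ []) ys = ℕ.+-monoʳ-≤ (count (x ∷ [])) le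

  count-≤-∷ : ∀ x xs → count xs ℕ.≤ count (x ∷ xs)
  count-≤-∷ x xs rewrite count-++ (x ∷ []) xs = ℕ.m≤n+m (count xs) (count (x ∷ []))

  count-accept-∷ : ∀ {x xs} → P x → count (x ∷ xs) ≡ ℕ.suc (count xs)
  count-accept-∷ px = cong length (filter-accept P? px)

  -- Up to order, the two lists differ only in `x` against `y`. In the exchange step `x` is the
  -- letter moved to the front and `y` the deleted one.
  count-swap : ∀ {x y} xs ys → (P x → P y) → count (x ∷ xs ++ ys) ℕ.≤ count (xs ++ y ∷ ys)
  count-swap {x} {y} xs ys imp
    rewrite count-++ (x ∷ []) (xs ++ ys) | count-++ xs ys | count-++ xs (y ∷ ys)
          | count-++ (y ∷ []) ys = begin
      cx ℕ.+ (count xs ℕ.+ count ys)  ≡⟨ x∙yz≈y∙xz cx (count xs) (count ys) ⟩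
      count xs ℕ.+ (cx ℕ.+ count ys)  ≤⟨ ℕ.+-monoʳ-≤ (count xs) (ℕ.+-monoˡ-≤ (count ys) cx≤cy) ⟩
      count xs ℕ.+ (cy ℕ.+ count ys)  ∎
    where
    open ℕ.≤-Reasoning
    open CommutativeSemigroupProperties ℕ.+-commutativeSemigroup using (x∙yz≈y∙xz)
    cx = count (x ∷ [])
    cy = count (y ∷ [])
    cx≤cy : cx ℕ.≤ cy
    cx≤cy with P? x | P? y
    ... | yes px | no ¬py = ⊥-elim (¬py (imp px))
    ... | yes _  | yes _  = ℕ.≤-refl
    ... | no _   | _      = ℕ.z≤n

  count≡0⇒All¬ : ∀ xs → count xs ≡ 0 → All (λ x → ¬ P x) xs
  count≡0⇒All¬ []       _  = []
  count≡0⇒All¬ (x ∷ xs) eq with P? x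
  count≡0⇒All¬ (x ∷ xs) eq | no ¬px = ¬px ∷ count≡0⇒All¬ xs eq
  count≡0⇒All¬ (x ∷ xs) () | yes _

-- Words and their action on vectors and roots.

module WeylGroupProperties {c ℓ₁ ℓ₂ m ℓm} {K : OrderedField c ℓ₁ ℓ₂} {E : EuclideanSpace K m ℓm}
                           {Φ : RootSystem E} {r : ℕ} (Δ : SimpleSystem Φ r) where
  open OrderedField K
  open OrderedFieldProperties K
  open EuclideanSpace E
  open EuclideanSpaceProperties E
  open RootSystem Φ
  open SimpleSystem Δ
  open SimpleSystemProperties Δ
  open WeylGroup Δ

  act-linear : ∀ R → Linear (act (eval R))
  act-linear []      = id-linear
  act-linear (i ∷ R) = ∘-linear (reflect-linear (simpleRoot i)) (act-linear R)

  -- The action of the inverse of `eval R`. It consumes the word from the left, so a root can be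
  -- followed through the successive prefixes.
  undo : Word → Carrierᴹ → Carrierᴹ
  undo []      v = v
  undo (i ∷ R) v = undo R (reflect (simpleRoot i) v)

  undo-linear : ∀ R → Linear (undo R)
  undo-linear []      = id-linear
  undo-linear (i ∷ R) = ∘-linear (undo-linear R) (reflect-linear (simpleRoot i))

  act-++ : ∀ R Q v → act (eval (R ++ Q)) v ≡ act (eval R) (act (eval Q) v)
  act-++ []      Q v = refl
  act-++ (i ∷ R) Q v = cong (reflect (simpleRoot i)) (act-++ R Q v)

  undo-++ : ∀ R Q v → undo (R ++ Q) v ≡ undo Q (undo R v)
  undo-++ []      Q v = refl
  undo-++ (i ∷ R) Q v = undo-++ R Q (reflect (simpleRoot i) v)

  s-involutive : ∀ i v → reflect (simpleRoot i) (reflect (simpleRoot i) v) ≈ᴹ v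
  s-involutive i = reflect-involutive (simple≉0 i)

  act-undo : ∀ R v → act (eval R) (undo R v) ≈ᴹ v
  act-undo []      v = ≈ᴹ-refl
  act-undo (i ∷ R) v = ≈ᴹ-trans (Linear.resp-≈ (reflect-linear (simpleRoot i)) (act-undo R _))
                                (s-involutive i v)

  undo-act : ∀ R v → undo R (act (eval R) v) ≈ᴹ v
  undo-act []      v = ≈ᴹ-refl
  undo-act (i ∷ R) v = ≈ᴹ-trans (Linear.resp-≈ (undo-linear R) (s-involutive i _)) (undo-act R v)

  eval-∷ : ∀ i R Q → eval R ≈ʷ eval Q → eval (i ∷ R) ≈ʷ eval (i ∷ Q)
  eval-∷ i R Q R≈Q v = Linear.resp-≈ (reflect-linear (simpleRoot i)) (R≈Q v)

  undo-resp-≈ʷ : ∀ R Q → eval R ≈ʷ eval Q → ∀ v → undo R v ≈ᴹ undo Q v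
  undo-resp-≈ʷ R Q R≈Q v = begin
    undo R v                           ≈⟨ R.resp-≈ (act-undo Q v) ⟨
    undo R (act (eval Q) (undo Q v))   ≈⟨ R.resp-≈ (R≈Q (undo Q v)) ⟨
    undo R (act (eval R) (undo Q v))   ≈⟨ undo-act R (undo Q v) ⟩
    undo Q v                           ∎
    where open SetoidReasoning ≈ᴹ-setoid
          module R = Linear (undo-linear R)

  undo-isRoot : ∀ R {v} → IsRoot v → IsRoot (undo R v)
  undo-isRoot []      v-root = v-root
  undo-isRoot (i ∷ R) v-root = undo-isRoot R (reflect-isRoot i v-root)

  Supported-undo : ∀ {D R v} → All (_∈ D) R → Supported D v → Supported D (undo R v)
  Supported-undo []          supp = supp
  Supported-undo (i∈D ∷ R⊆D) supp = Supported-undo R⊆D (Supported-reflect i∈D supp)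

  undo-coordinate : ∀ {k R} → All (_≢ k) R → ∀ x → ∃ λ y → undo R (lin x) ≈ᴹ lin y × y k ≈ x k
  undo-coordinate []                   x = x , ≈ᴹ-refl , ≈-refl
  undo-coordinate {k} {i ∷ R} (i≢k ∷ R∌k) x
    with y , eq , yₖ≈ ← undo-coordinate R∌k (λ j → x j + (- cartan (lin x) (simpleRoot i)) * unit i j) =
    y , ≈ᴹ-trans (Linear.resp-≈ (undo-linear R) (reflect-lin i x)) eq ,
    ≈-trans yₖ≈ (reflect-lin-off (λ k≡i → i≢k (sym k≡i)) (x k) _)

  -- The exchange condition.

  record Deletion (R : Word) (β : Carrierᴹ) : Set (m ⊔ ℓm) where
    field
      prefix suffix : Word
      letter        : Fin r
      split         : R ≡ prefix ++ letter ∷ suffix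
      undo-prefix   : undo prefix β ≈ᴹ simpleRoot letter
      deleted       : ∀ v → act (eval (prefix ++ suffix)) v ≈ᴹ reflect β (act (eval R) v)

    shortened : Word
    shortened = prefix ++ suffix

    length-shortened : length R ≡ ℕ.suc (length shortened)
    length-shortened = begin
      length R                                     ≡⟨ cong length split ⟩
      length (prefix ++ letter ∷ suffix)           ≡⟨ length-++ prefix ⟩
      length prefix ℕ.+ ℕ.suc (length suffix)      ≡⟨ ℕ.+-suc (length prefix) (length suffix) ⟩
      ℕ.suc (length prefix ℕ.+ length suffix)      ≡⟨ cong ℕ.suc (length-++ prefix) ⟨
      ℕ.suc (length shortened)                     ∎
      where open ≡-Reasoning

    All-shortened : ∀ {q} {Q : Fin r → Set q} → All Q R → All Q shortened
    All-shortened qs with qs₁ , _ ∷ qs₂ ← All.++⁻ prefix (subst (All _) split qs) = All.++⁺ qs₁ qs₂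

  -- Follow `β` through the prefixes of `R` until a letter first turns it negative; there the
  -- travelling root is the simple root of that letter. The reflection in `β` passes the earlier
  -- letters by conjugation and cancels this one.
  deletion : ∀ R {β} → IsRoot β → Pos β → Neg (undo R β) → Deletion R β
  deletion []      β-root pos neg = ⊥-elim (¬Pos×Neg β-root pos neg)
  deletion (i ∷ R) {β} β-root pos neg with root-sign (reflect-isRoot i β-root)
  ... | inj₁ pos′ = record
    { prefix = i ∷ D.prefix ; suffix = D.suffix ; letter = D.letter
    ; split = cong (i ∷_) D.split
    ; undo-prefix = D.undo-prefix
    ; deleted = λ v → ≈ᴹ-trans (Linear.resp-≈ (reflect-linear (simpleRoot i)) (D.deleted v))
                               (≈ᴹ-sym (reflect-conjugate (simple≉0 i) β _))
    }
    where module D = Deletion (deletion R (reflect-isRoot i β-root) pos′ neg)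
  ... | inj₂ neg′ = record
    { prefix = [] ; suffix = R ; letter = i
    ; split = refl
    ; undo-prefix = β≈α
    ; deleted = λ v → ≈ᴹ-sym (≈ᴹ-trans (reflect-congˡ β≈α _) (s-involutive i _))
    }
    where β≈α = Pos-flipped⇒simple i β-root pos neg′

  descent-deletion : ∀ R j → Neg (undo R (simpleRoot j)) → Deletion R (simpleRoot j)
  descent-deletion R j = deletion R (simple-isRoot j) (Pos-simple j)

  -- Reduced words and the sign criterion for lengthening.

  Minimal : Word → Set (m ⊔ ℓm)
  Minimal R = ∀ Q → eval Q ≈ʷ eval R → length R ℕ.≤ length Q

  Minimal⇒HasLength : ∀ R {w} → Minimal R → eval R ≈ʷ w → HasLength w (length R)
  Minimal⇒HasLength R min R≈w =
    (R , R≈w , refl) , λ Q Q≈w → min Q (λ v → ≈ᴹ-trans (Q≈w v) (≈ᴹ-sym (R≈w v)))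

  IsReducedExpression⇒Minimal : ∀ R {w} → IsReducedExpression R w → Minimal R
  IsReducedExpression⇒Minimal R (R≈w , _ , min) Q Q≈R = min Q (λ v → ≈ᴹ-trans (Q≈R v) (R≈w v))

  Minimal-resp : ∀ R Q → eval Q ≈ʷ eval R → length Q ≡ length R → Minimal R → Minimal Q
  Minimal-resp R Q Q≈R len min X X≈Q =
    subst (ℕ._≤ length X) (sym len) (min X (λ v → ≈ᴹ-trans (X≈Q v) (Q≈R v)))

  Minimal-++ʳ : ∀ P Q → Minimal (P ++ Q) → Minimal Q
  Minimal-++ʳ P Q min X X≈Q = ℕ.+-cancelˡ-≤ (length P) _ _ (begin
    length P ℕ.+ length Q  ≡⟨ length-++ P ⟨
    length (P ++ Q)        ≤⟨ min (P ++ X) PX≈PQ ⟩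
    length (P ++ X)        ≡⟨ length-++ P ⟩
    length P ℕ.+ length X  ∎)
    where
    open ℕ.≤-Reasoning
    PX≈PQ : eval (P ++ X) ≈ʷ eval (P ++ Q)
    PX≈PQ v rewrite act-++ P X v | act-++ P Q v = Linear.resp-≈ (act-linear P) (X≈Q v)

  Minimal-++ˡ : ∀ P Q → Minimal (P ++ Q) → Minimal P
  Minimal-++ˡ P Q min X X≈P = ℕ.+-cancelʳ-≤ (length Q) _ _ (begin
    length P ℕ.+ length Q  ≡⟨ length-++ P ⟨
    length (P ++ Q)        ≤⟨ min (X ++ Q) XQ≈PQ ⟩
    length (X ++ Q)        ≡⟨ length-++ X ⟩
    length X ℕ.+ length Q  ∎)
    where
    open ℕ.≤-Reasoning
    XQ≈PQ : eval (X ++ Q) ≈ʷ eval (P ++ Q)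
    XQ≈PQ v rewrite act-++ X Q v | act-++ P Q v = X≈P (act (eval Q) v)

  -- If the root were negative, a deletion from `R` would spell the same element as `j ∷ R` with two
  -- letters fewer.
  Minimal-∷⇒Pos : ∀ j R → Minimal (j ∷ R) → Pos (undo R (simpleRoot j))
  Minimal-∷⇒Pos j R min with root-sign (undo-isRoot R (simple-isRoot j))
  ... | inj₁ pos = pos
  ... | inj₂ neg = ⊥-elim (ℕ.1+n≰n (ℕ.≤-trans (ℕ.n≤1+n _)
                     (subst (λ n → ℕ.suc n ℕ.≤ length D.shortened) D.length-shortened
                            (min D.shortened D.deleted))))
    where module D = Deletion (descent-deletion R j neg)

  -- Any competitor `Q` sends the `j`-th simple root to a negative root, because `s j` negates it
  -- first. A deletion from `Q` then spells `eval R`, so `Q` has at least one letter more than `R`.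
  Pos⇒Minimal-∷ : ∀ j R → Minimal R → Pos (undo R (simpleRoot j)) → Minimal (j ∷ R)
  Pos⇒Minimal-∷ j R min pos Q Q≈jR =
    subst (ℕ.suc (length R) ℕ.≤_) (sym D.length-shortened) (ℕ.s≤s (min D.shortened shortened≈R))
    where
    open SetoidReasoning ≈ᴹ-setoid
    α = simpleRoot j

    undo-Q : -ᴹ (undo R α) ≈ᴹ undo Q α
    undo-Q = begin
      -ᴹ (undo R α)         ≈⟨ Linear.homo-neg (undo-linear R) α ⟨
      undo R (-ᴹ α)         ≈⟨ Linear.resp-≈ (undo-linear R) (reflect-self (simple≉0 j)) ⟨
      undo (j ∷ R) α        ≈⟨ undo-resp-≈ʷ Q (j ∷ R) Q≈jR α ⟨
      undo Q α              ∎

    module D = Deletion (descent-deletion Q j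
      (Neg-resp-≈ undo-Q (Pos-resp-≈ (≈ᴹ-sym (-ᴹ-involutive _)) pos)))

    shortened≈R : eval D.shortened ≈ʷ eval R
    shortened≈R v = ≈ᴹ-trans (D.deleted v)
      (≈ᴹ-trans (Linear.resp-≈ (reflect-linear α) (Q≈jR v)) (s-involutive j _))

  -- Prefixing `j` to any word for the shortened element gives a word for `eval R`, so no such word
  -- can save more than the one deleted letter.
  Minimal-shortened : ∀ j R → Minimal R → (D : Deletion R (simpleRoot j)) →
                      Minimal (Deletion.shortened D)
  Minimal-shortened j R min D X X≈ = ℕ.s≤s⁻¹
    (subst (ℕ._≤ ℕ.suc (length X)) D.length-shortened (min (j ∷ X) jX≈R))
    where
    module D = Deletion D
    jX≈R : eval (j ∷ X) ≈ʷ eval R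
    jX≈R v = ≈ᴹ-trans (Linear.resp-≈ (reflect-linear (simpleRoot j)) (≈ᴹ-trans (X≈ v) (D.deleted v)))
                      (s-involutive j _)

  -- Letters are only kept or deleted, so a word in a parabolic subgroup stays in it. The sign of
  -- the travelling root decides between prepending and deleting.
  reduce : ∀ R → ∃ λ Q → eval Q ≈ʷ eval R × Minimal Q × (∀ {D} → All (_∈ D) R → All (_∈ D) Q)
  reduce [] = [] , (λ _ → ≈ᴹ-refl) , (λ _ _ → ℕ.z≤n) , λ _ → []
  reduce (j ∷ R) with Q , Q≈R , min , sub ← reduce R with root-sign (undo-isRoot Q (simple-isRoot j))
  ... | inj₁ pos = j ∷ Q , eval-∷ j Q R Q≈R , Pos⇒Minimal-∷ j Q min pos , λ { (j∈ ∷ R⊆) → j∈ ∷ sub R⊆ }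
  ... | inj₂ neg = D.shortened
                 , (λ v → ≈ᴹ-trans (D.deleted v) (eval-∷ j Q R Q≈R v))
                 , Minimal-shortened j Q min (descent-deletion Q j neg)
                 , λ { (_ ∷ R⊆) → D.All-shortened (sub R⊆) }
    where module D = Deletion (descent-deletion Q j neg)

  -- Longest elements of parabolic subgroups.

  -- Each letter of Z, read from the right, deletes one letter of P.
  absorb : ∀ {D} P → (∀ j → j ∈ D → Neg (undo P (simpleRoot j))) →
           ∀ Z → All (_∈ D) Z → Minimal Z →
           ∃ λ Q → length Z ℕ.+ length Q ≡ length P × eval Q ≈ʷ eval (Z ++ P)
  absorb P neg []      []          _   = P , refl , λ _ → ≈ᴹ-refl
  absorb P neg (j ∷ Z) (j∈D ∷ Z⊆D) min
    with Q , len , Q≈ZP ← absorb P neg Z Z⊆D (Minimal-++ʳ (j ∷ []) Z min) =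
    X.shortened , len′ , λ v → ≈ᴹ-trans (X.deleted v) (eval-∷ j Q (Z ++ P) Q≈ZP v)
    where
    α = simpleRoot j

    -- As `j ∷ Z` is reduced, `undo Z α` is positive; it is also supported on `D`, where `undo P`
    -- negates every simple root.
    neg-ZP : Neg (undo P (undo Z α))
    neg-ZP = linear-Pos (∘-linear neg-linear (undo-linear P)) neg
      (Supported-undo Z⊆D (Supported-simple j∈D)) (Minimal-∷⇒Pos j Z min)

    undo-Q : undo P (undo Z α) ≈ᴹ undo Q α
    undo-Q = ≈ᴹ-sym (≈ᴹ-trans (undo-resp-≈ʷ Q (Z ++ P) Q≈ZP α) (≈ᴹ-reflexive (undo-++ Z P α)))

    module X = Deletion (descent-deletion Q j (Neg-resp-≈ undo-Q neg-ZP))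

    len′ : ℕ.suc (length Z ℕ.+ length X.shortened) ≡ length P
    len′ = trans (sym (ℕ.+-suc (length Z) (length X.shortened)))
          (trans (cong (length Z ℕ.+_) (sym X.length-shortened)) len)

  module _ {D} P (P⊆D : All (_∈ D) P) (min : Minimal P)
           (neg : ∀ j → j ∈ D → Neg (undo P (simpleRoot j))) where

    -- Reduce a word for `y` inside `D` and absorb it into `P`: every letter costs one letter of
    -- `P`, so the length of `y` is at most that of `P`.
    longest : IsLongestElement D (eval P)
    longest = (P , P⊆D , λ _ → ≈ᴹ-refl) , λ { y (Y , Y⊆D , Y≈y) → dominates y Y Y⊆D Y≈y }
      where
      dominates : ∀ y Y → All (_∈ D) Y → eval Y ≈ʷ y → y ≤ℓ eval P
      dominates y Y Y⊆D Y≈y with Z , Z≈Y , Z-min , sub ← reduce Y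
        with _ , len , _ ← absorb P neg Z (sub Y⊆D) Z-min =
        length Z , length P
        , Minimal⇒HasLength Z {y} Z-min (λ v → ≈ᴹ-trans (Z≈Y v) (Y≈y v))
        , Minimal⇒HasLength P {eval P} min (λ _ → ≈ᴹ-refl)
        , subst (length Z ℕ.≤_) len (ℕ.m≤m+n (length Z) _)

    -- Absorbing `P` into itself uses up all its letters; the word left for the square is empty.
    longest-involutive : ∀ v → act (eval P) (act (eval P) v) ≈ᴹ v
    longest-involutive v with absorb P neg P P⊆D min
    ... | []    , _   , ε≈PP = ≈ᴹ-sym (≈ᴹ-trans (ε≈PP v) (≈ᴹ-reflexive (act-++ P P v)))
    ... | _ ∷ _ , len , _    = ⊥-elim (ℕ.m+1+n≢m (length P) len)

  -- If the root were positive, `j ∷ R` would be reduced, and every word for `s j · w` would be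
  -- longer than `R`, against the descent.
  descent⇒Neg : ∀ R w {j} → Minimal R → eval R ≈ʷ w → J w j → Neg (undo R (simpleRoot j))
  descent⇒Neg R w {j} min R≈w (k , l , ((T , T≈sw , |T|≡k) , _) , (_ , l-min) , k<l)
    with root-sign (undo-isRoot R (simple-isRoot j))
  ... | inj₂ neg = neg
  ... | inj₁ pos = ⊥-elim (ℕ.<-irrefl refl (begin-strict
    length R          ≤⟨ ℕ.n≤1+n _ ⟩
    length (j ∷ R)    ≤⟨ Pos⇒Minimal-∷ j R min pos T T≈jR ⟩
    length T          ≡⟨ |T|≡k ⟩
    k                 <⟨ k<l ⟩
    l                 ≤⟨ l-min R R≈w ⟩
    length R          ∎))
    where
    open ℕ.≤-Reasoning
    T≈jR : eval T ≈ʷ eval (j ∷ R)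
    T≈jR v = ≈ᴹ-trans (T≈sw v)
      (Linear.resp-≈ (reflect-linear (simpleRoot j)) (≈ᴹ-sym (R≈w v)))

  -- Supports and letter counts relative to `I`.

  Closed : Subset r → Subset r → Set ℓ₁
  Closed I D = ∀ i k → i ∈ D → k ∈ I → k ∉ D → ⟨ simpleRoot i , simpleRoot k ⟩ ≈ 0#

  -- A vertex of `I` not orthogonal to some vertex of `C` would extend a path from the base vertex
  -- by one edge and so lie in `C`.
  IsComponent⇒Closed : ∀ {I C} → IsComponent I C → Closed I C
  IsComponent⇒Closed {I} {C} (b , b∈I , C⇔) i k i∈C k∈I k∉C
    with ⟨ simpleRoot i , simpleRoot k ⟩ ≈? 0#
  ... | yes ≈0 = ≈0
  ... | no  ≉0 with i∈I , b⟶i ← Equivalence.to (C⇔ i) i∈C =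
    ⊥-elim (k∉C (Equivalence.from (C⇔ k)
      (k∈I , b⟶i ◅◅ (i∈I , k∈I , (λ { refl → k∉C i∈C }) , ≉0) ◅ ε★)))

  OnceOutside : Subset r → Word → Set
  OnceOutside I R = ∀ j → j ∉ I → #letter j R ℕ.≤ 1

  OnceOutside-tail : ∀ {I} j R → OnceOutside I (j ∷ R) → OnceOutside I R
  OnceOutside-tail j R once k k∉I = ℕ.≤-trans (count-≤-∷ (_≟ k) j R) (once k k∉I)

  -- The only letter that changes the coordinate of β at k ∉ I is k itself, and it occurs
  -- once; as that coordinate vanishes at the end, it never leaves 0.
  undo-simple⇒∈ : ∀ {I D} → Closed I D → ∀ U i V {β} → OnceOutside I (U ++ i ∷ V) →
                  Supported D β → undo U β ≈ᴹ simpleRoot i → i ∈ D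
  undo-simple⇒∈ closed []      i V once supp β≈αᵢ = Supported-simple⇒∈ (Supported-resp-≈ β≈αᵢ supp)
  undo-simple⇒∈ {I} {D} closed (k ∷ U) i V {β} once supp@(x , off , β≈x) eq =
    undo-simple⇒∈ closed U i V (OnceOutside-tail k (U ++ i ∷ V) once) supp′ eq
    where
    supp′ : Supported D (reflect (simpleRoot k) β)
    supp′ with k ∈? D | k ∈? I
    ... | yes k∈D | _       = Supported-reflect k∈D supp
    -- By closedness this letter is orthogonal to the support and leaves the root unchanged.
    ... | no  k∉D | yes k∈I = Supported-reflect-⊥ (λ j j∈D → closed j k j∈D k∈I k∉D) supp
    ... | no  k∉D | no  k∉I =
      Supported-resp-≈ (≈ᴹ-sym sβ≈) (reflect-support k off (λ _ → xₖ≈0))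
      where
      sβ≈ = Linear.resp-≈ (reflect-linear (simpleRoot k)) β≈x
      x′ : Fin r → Carrier
      x′ j = x j + (- cartan (lin x) (simpleRoot k)) * unit k j

      absent : All (_≢ k) (U ++ i ∷ V)
      absent = count≡0⇒All¬ (_≟ k) (U ++ i ∷ V) (ℕ.n≤0⇒n≡0 (ℕ.s≤s⁻¹
        (subst (ℕ._≤ 1) (count-accept-∷ (_≟ k) {xs = U ++ i ∷ V} refl) (once k k∉I))))

      i≢k : i ≢ k
      i≢k = All.head (All.++⁻ʳ U absent)

      xₖ≈0 : x′ k ≈ 0#
      xₖ≈0 with y , undo≈y , yₖ≈x′ₖ ← undo-coordinate (All.++⁻ˡ U absent) x′ =
        ≈-trans (≈-sym yₖ≈x′ₖ) (≈-trans (lin-injective y≈unit k)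
          (≈-reflexive (unit-off {k = i} {k} (λ k≡i → i≢k (sym k≡i)))))
        where
        open SetoidReasoning ≈ᴹ-setoid
        y≈unit : lin y ≈ᴹ lin (unit i)
        y≈unit = begin
          lin y                                  ≈⟨ undo≈y ⟨
          undo U (lin x′)                        ≈⟨ Linear.resp-≈ (undo-linear U) (reflect-lin k x) ⟨
          undo U (reflect (simpleRoot k) (lin x)) ≈⟨ Linear.resp-≈ (undo-linear U) sβ≈ ⟨
          undo U (reflect (simpleRoot k) β)      ≈⟨ eq ⟩
          simpleRoot i                           ≈⟨ lin-unit i ⟨
          lin (unit i)                           ∎

  -- Compares exactly the counts that a witness bounds, with closed sets in place of components.
  -- Being a preorder, it can be accumulated over successive exchanges.
  record _≼[_]_ (Q : Word) (I : Subset r) (R : Word) : Set ℓ₁ where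
    field
      outside : ∀ k → k ∉ I → #letter k Q ℕ.≤ #letter k R
      closed  : ∀ {D} → Closed I D → #letters D Q ℕ.≤ #letters D R
  open _≼[_]_

  ≼-refl : ∀ {I R} → R ≼[ I ] R
  ≼-refl = record { outside = λ _ _ → ℕ.≤-refl ; closed = λ _ → ℕ.≤-refl }

  ≼-trans : ∀ {I P Q R} → P ≼[ I ] Q → Q ≼[ I ] R → P ≼[ I ] R
  ≼-trans P≼Q Q≼R = record
    { outside = λ k k∉I → ℕ.≤-trans (outside P≼Q k k∉I) (outside Q≼R k k∉I)
    ; closed  = λ cl → ℕ.≤-trans (closed P≼Q cl) (closed Q≼R cl)
    }

  ≼-∷ : ∀ {I} j {Q R} → Q ≼[ I ] R → (j ∷ Q) ≼[ I ] (j ∷ R)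
  ≼-∷ j Q≼R = record
    { outside = λ k k∉I → count-∷-mono (_≟ k) j (outside Q≼R k k∉I)
    ; closed  = λ {D} cl → count-∷-mono (_∈? D) j (closed Q≼R cl)
    }

  OnceOutside-≼ : ∀ {I Q R} → Q ≼[ I ] R → OnceOutside I R → OnceOutside I Q
  OnceOutside-≼ Q≼R once k k∉I = ℕ.≤-trans (outside Q≼R k k∉I) (once k k∉I)

  -- The new letter `j` lies in `I`, so no count outside `I` grows. If `j` lies in a closed `D`,
  -- then `undo-prefix` and `undo-simple⇒∈` put the deleted letter in `D` as well, and the count of
  -- `D` is not raised.
  exchange-≼ : ∀ {I j R} → OnceOutside I R → j ∈ I → (D : Deletion R (simpleRoot j)) →
               (j ∷ Deletion.shortened D) ≼[ I ] R
  exchange-≼ {I} {j} once j∈I record { prefix = U ; suffix = V ; letter = i ; split = refl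
                                     ; undo-prefix = eq } = record
    { outside = λ k k∉I → count-swap (_≟ k) {x = j} {i} U V
        (λ { refl → ⊥-elim (k∉I j∈I) })
    ; closed  = λ {D} cl → count-swap (_∈? D) U V
        (λ j∈D → undo-simple⇒∈ cl U i V once (Supported-simple j∈D) eq)
    }

  -- Moving all descents in `I` to the front.

  record Factorization (I : Subset r) (R : Word) : Set (c ⊔ ℓ₁ ⊔ ℓ₂ ⊔ m ⊔ ℓm) where
    field
      left right : Word
      left⊆I     : All (_∈ I) left
      equal      : eval (left ++ right) ≈ʷ eval R
      length-≡   : length (left ++ right) ≡ length R
      ascents    : ∀ j → j ∈ I → Pos (undo right (simpleRoot j))
      letters    : (left ++ right) ≼[ I ] R

  -- Recursion on the length `n`: each exchange leaves a shorter word to treat. The search for a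
  -- descent is decidable because every root has a sign; when it fails, all simple roots of `I`
  -- remain positive, which is `ascents`.
  factorize : ∀ {I} n R → length R ≡ n → OnceOutside I R → Factorization I R
  factorize {I} n R len once with any? (λ j → (j ∈? I) ×-dec neg? j)
    where
    neg? : ∀ j → Dec (Neg (undo R (simpleRoot j)))
    neg? j with root-sign (undo-isRoot R (simple-isRoot j))
    ... | inj₁ pos = no (¬Pos×Neg (undo-isRoot R (simple-isRoot j)) pos)
    ... | inj₂ neg = yes neg
  factorize {I} n R len once | no none = record
    { left = [] ; right = R ; left⊆I = [] ; equal = λ _ → ≈ᴹ-refl ; length-≡ = refl
    ; ascents = ascents ; letters = ≼-refl }
    where
    ascents : ∀ j → j ∈ I → Pos (undo R (simpleRoot j))
    ascents j j∈I with root-sign (undo-isRoot R (simple-isRoot j))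
    ... | inj₁ pos = pos
    ... | inj₂ neg = ⊥-elim (none (j , j∈I , neg))
  -- A deletion presupposes a letter, so the empty word has no descent.
  factorize ℕ.zero    R len once | yes (j , j∈I , neg) =
    case trans (sym (Deletion.length-shortened (descent-deletion R j neg))) len of λ ()
  factorize {I} (ℕ.suc n) R len once | yes (j , j∈I , neg) = record
    { left = j ∷ F.left ; right = F.right ; left⊆I = j∈I ∷ F.left⊆I
    -- Deleting a letter multiplies by `s j` on the left, and the `j` put in front cancels it.
    ; equal = λ v → ≈ᴹ-trans (eval-∷ j (F.left ++ F.right) X.shortened F.equal v)
        (≈ᴹ-trans (eval-∷ j X.shortened (j ∷ R) X.deleted v) (s-involutive j _))
    ; length-≡ = trans (cong ℕ.suc F.length-≡) (sym X.length-shortened)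
    ; ascents = F.ascents
    ; letters = ≼-trans (≼-∷ j F.letters) jX≼R
    }
    where
    D = descent-deletion R j neg
    module X = Deletion D
    jX≼R = exchange-≼ once j∈I D
    module F = Factorization (factorize n X.shortened
      (ℕ.suc-injective (trans (sym X.length-shortened) len))
      (OnceOutside-tail j X.shortened (OnceOutside-≼ jX≼R once)))

  longest-prefix :
    ∀ {I w R} → (∀ j → j ∈ I → J w j) → IsWitness I w R → Factorization I R →
    ∃ λ w₀ → IsLongestElement I w₀ ×
    (∃₂ λ R′ R″ → IsReducedExpression R′ w₀
                × IsReducedExpression R″ (w₀ · w)
                × IsWitness I w (R′ ++ R″))
  longest-prefix {I} {w} {R} descents witness F =
    eval P , longest P F.left⊆I P-min P-neg , P , Q
    , ((λ _ → ≈ᴹ-refl) , Minimal⇒HasLength P {eval P} P-min (λ _ → ≈ᴹ-refl))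
    , (Q≈ , Minimal⇒HasLength Q {eval P · w} (Minimal-++ʳ P Q PQ-min) Q≈)
    , record
      { reducedExpression = PQ≈w , Minimal⇒HasLength (P ++ Q) {w} PQ-min PQ≈w
      ; outside           = OnceOutside-≼ F.letters Wit.outside
      ; components        = λ C comp → let x , k , lx , hx , bound = Wit.components C comp in
          x , k , lx , hx , ℕ.≤-trans (closed F.letters (IsComponent⇒Closed comp)) bound
      }
    where
    module Wit = IsWitness witness
    module F = Factorization F
    P = F.left
    Q = F.right

    PQ≈w : eval (P ++ Q) ≈ʷ w
    PQ≈w v = ≈ᴹ-trans (F.equal v) (proj₁ Wit.reducedExpression v)

    PQ-min : Minimal (P ++ Q)
    PQ-min = Minimal-resp R (P ++ Q) F.equal F.length-≡
      (IsReducedExpression⇒Minimal R {w} Wit.reducedExpression)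

    P-min : Minimal P
    P-min = Minimal-++ˡ P Q PQ-min

    P-neg : ∀ j → j ∈ I → Neg (undo P (simpleRoot j))
    P-neg j j∈I with root-sign (undo-isRoot P (simple-isRoot j))
    ... | inj₂ neg = neg
    -- A positive `undo P` image would be supported on `I`, and `ascents` would keep it positive
    -- under `undo Q`; but `j` is a descent of `w`, so the image under all of `P ++ Q` is negative.
    ... | inj₁ pos = ⊥-elim (¬Pos×Neg (undo-isRoot (P ++ Q) (simple-isRoot j))
      (subst Pos (sym (undo-++ P Q _)) (linear-Pos (undo-linear Q) F.ascents
        (Supported-undo F.left⊆I (Supported-simple j∈I)) pos))
      (descent⇒Neg (P ++ Q) w PQ-min PQ≈w (descents j j∈I)))

    -- Since `eval P` is an involution, cancelling it from `w` on the left amounts to multiplying by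
    -- it.
    Q≈ : eval Q ≈ʷ eval P · w
    Q≈ v = begin
      act (eval Q) v                                   ≈⟨ longest-involutive P F.left⊆I P-min P-neg _ ⟨
      act (eval P) (act (eval P) (act (eval Q) v))     ≡⟨ cong (act (eval P)) (act-++ P Q v) ⟨
      act (eval P) (act (eval (P ++ Q)) v)             ≈⟨ Linear.resp-≈ (act-linear P) (PQ≈w v) ⟩
      act (eval P) (act w v)                           ∎
      where open SetoidReasoning ≈ᴹ-setoid

proposition2p6 : ∀ {c ℓ₁ ℓ₂ m ℓm : Level} {K : OrderedField c ℓ₁ ℓ₂} {E : EuclideanSpace K m ℓm}
    (Φ : RootSystem E) (r : ℕ) (Δ : SimpleSystem Φ r) →
    let open WeylGroup Δ in
    (w : W) (I : Subset r) →
    (∀ j → j ∈ I → J w j) →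
    IsSpherical I w →
    ∃ λ w₀ → IsLongestElement I w₀ ×
    (∃₂ λ R′ R″ → IsReducedExpression R′ w₀
    × IsReducedExpression R″ (w₀ · w)
    × IsWitness I w (R′ ++ R″))
proposition2p6 Φ r Δ w I descents (R , witness) =
  longest-prefix descents witness
    (factorize (length R) R refl (WeylGroup.IsWitness.outside witness))
  where open WeylGroupProperties Δ
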